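{- Let $\mathcal{L}\subseteq\mathrm{Lin}$ be nonempty, downward $\preceq$-closed and ccs. If either $\boldsymbol{\omega}^*\in\mathcal{L}$ or $\boldsymbol{\omega}\in\mathcal{L}$, then $\{\boldsymbol{\omega},\boldsymbol{\omega}^*\}$ is a basis for $\trianglelefteq^{\mathcal{L}}_{\mathrm{LO}}$.
   Context: Linear orders are reflexive and nonempty. $L\preceq L'$ means there is an embedding $f:L\to L'$, i.e. $x\le_L y\iff f(x)\le_{L'}f(y)$. $\mathrm{LO}\subseteq 2^{\mathbb{N}\times\mathbb{N}}$ is the set of (codes for) linear orders with domain $\mathbb{N}$; $\mathrm{Fin}$ is the set of (codes for) nonempty linear orders on finite subsets of $\mathbb{N}$; $\mathrm{Lin}=\mathrm{Fin}\cup\mathrm{LO}$. $\boldsymbol{\omega}\in\mathrm{LO}$ is a copy of $(\mathbb{N},\le)$ and $\boldsymbol{\omega}^*$ is its reverse. A class $\mathcal{L}\subseteq\mathrm{Lin}$ is downward $\preceq$-closed if $K\in\mathrm{Lin}$ and $K\preceq L\in\mathcal{L}$ imply $K\in\mathcal{L}$; membership in $\mathcal{L}$ is meant up to isomorphism. A subset $I$ of a linear order $L$ is convex if $x\le_L y\le_L z$ and $x,z\in I$ imply $y\in I$. For $A,B\subseteq L$ write $A\le_L B$ (resp. $A<_L B$) if $a\le_L b$ (resp. $a<_L b$) for all $a\in A$, $b\in B$. A $K$-convex partition of $L$ is a partition $(L_k)_{k\in K}$ of $L$ (into nonempty sets) such that $k<_K k'\iff L_k<_L L_{k'}$. The relation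 $L\trianglelefteq^{\mathcal{L}}L'$ holds iff there are $K\in\mathcal{L}$, a $K$-convex partition $(L_k)_{k\in K}$ of $L$, and an embedding $f$ of $L$ into $L'$ such that $f(L_k)$ is a convex subset of $L'$ for every $k\in K$. $\trianglelefteq^{\mathcal{L}}_{\mathrm{LO}}$ is its restriction to $\mathrm{LO}$. $\mathcal{L}$ is ccs (closed under convex sums) if for all $K,K'\in\mathcal{L}$ and every family $(K'_k)_{k\in K}$ of nonempty convex subsets of $K'$ such that $k_0<_K k_1\Rightarrow K'_{k_0}\le_{K'}K'_{k_1}$, we have $\sum_{k\in K}K'_k\in\mathcal{L}$, where $\sum_{k\in K}K'_k=\{(x,k): k\in K, x\in K'_k\}$ ordered antilexicographically. When $\mathcal{L}$ is ccs, $\trianglelefteq^{\mathcal{L}}$ is a quasi-order. A set $\mathcal{B}\subseteq X$ is a basis for a quasi-order $\precsim$ on $X$ if for every $x\in X$ there is $b\in\mathcal{B}$ with $b\precsim x$. -}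

module Defs where

open import Level using (Level; 0ℓ; suc; _⊔_)
open import Data.Bool.Base using (Bool; T)
open import Data.Bool.Properties using (T-irrelevant)
open import Data.List.Base using (List)
open import Data.List.Membership.Propositional using () renaming (_∈_ to _∈ˡ_)
open import Data.Nat.Base using (ℕ; _≤ᵇ_)
open import Data.Nat.Properties using (≤ᵇ⇒≤; ≤⇒≤ᵇ; ≤-refl; ≤-trans; ≤-antisym; ≤-total)
open import Data.Product.Base using (Σ; ∃; _×_; _,_; proj₁; swap)
open import Data.Product.Relation.Binary.Lex.NonStrict using (×-Lex)
open import Data.Sum.Base using () renaming (map to ⊎-map)
open import Function.Base using (_on_; flip; _∘_)
open import Function.Bundles using (_⇔_)
open import Relation.Binary.Core using (Rel)
open import Relation.Binary.Morphism.Structures using (IsOrderIsomorphism)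
open import Relation.Binary.PropositionalEquality
  using (_≡_; refl; isEquivalence)
open import Relation.Binary.Structures using (IsTotalOrder)
open import Relation.Unary using (Pred; _∈_; _∪_; Satisfiable)
import Relation.Binary.Construct.Flip.EqAndOrd as Flip
import Relation.Binary.Construct.NonStrictToStrict as NonStrictToStrict

private
  variable
    ℓ ℓ′ : Level

-- The points of 2^(ℕ×ℕ).
Code : Set
Code = ℕ → ℕ → Bool

-- Orders are reflexive, so the underlying set of a coded order is the set of
-- n with (n , n) in the code.
Dom : Code → Set
Dom c = ∃ λ n → T (c n n)

LE LT : (c : Code) → Rel (Dom c) 0ℓ
LE c x y = T (c (proj₁ x) (proj₁ y))
LT c     = NonStrictToStrict._<_ _≡_ (LE c)

infix 4 LE LT
syntax LE c x y = x ≤[ c ] y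
syntax LT c x y = x <[ c ] y

record IsLinear (c : Code) : Set where
  field
    -- The code is a subset of Dom × Dom.
    supported    : ∀ {m n} → T (c m n) → T (c m m) × T (c n n)
    isTotalOrder : IsTotalOrder _≡_ (LE c)

record LO (c : Code) : Set where
  field
    isLinear : IsLinear c
    full     : ∀ n → T (c n n)

record Fin (c : Code) : Set where
  field
    isLinear : IsLinear c
    nonempty : Dom c
    finite   : ∃ λ (xs : List (Dom c)) → ∀ x → x ∈ˡ xs

Lin : Pred Code 0ℓ
Lin = Fin ∪ LO

private
  ≤ᵇ-isTotalOrder : IsTotalOrder _≡_ (LE _≤ᵇ_)
  ≤ᵇ-isTotalOrder = record
    { isPartialOrder = record
      { isPreorder = record
        { isEquivalence = isEquivalence
        ; reflexive     = λ { {n , _} refl → ≤⇒≤ᵇ (≤-refl {n}) }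
        ; trans         = λ {x} {y} {z} p q →
            ≤⇒≤ᵇ (≤-trans (≤ᵇ⇒≤ (proj₁ x) (proj₁ y) p) (≤ᵇ⇒≤ (proj₁ y) (proj₁ z) q))
        }
      ; antisym = λ {x} {y} p q →
          ext x y (≤-antisym (≤ᵇ⇒≤ (proj₁ x) (proj₁ y) p) (≤ᵇ⇒≤ (proj₁ y) (proj₁ x) q))
      }
    ; total = λ x y → ⊎-map ≤⇒≤ᵇ ≤⇒≤ᵇ (≤-total (proj₁ x) (proj₁ y))
    }
    where
    ext : ∀ (x y : Dom _≤ᵇ_) → proj₁ x ≡ proj₁ y → x ≡ y
    ext (m , p) (_ , q) refl with refl ← T-irrelevant p q = refl

  ≤ᵇ-full : ∀ n → T (n ≤ᵇ n)
  ≤ᵇ-full n = ≤⇒≤ᵇ (≤-refl {n})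

ω : ∃ LO
ω = _≤ᵇ_ , record
  { isLinear = record
    { supported    = λ {m} {n} _ → ≤ᵇ-full m , ≤ᵇ-full n
    ; isTotalOrder = ≤ᵇ-isTotalOrder
    }
  ; full = ≤ᵇ-full
  }

ω* : ∃ LO
ω* = flip _≤ᵇ_ , record
  { isLinear = record
    { supported    = λ {m} {n} _ → ≤ᵇ-full m , ≤ᵇ-full n
    ; isTotalOrder = Flip.isTotalOrder ≤ᵇ-isTotalOrder
    }
  ; full = ≤ᵇ-full
  }

IsEmbedding : (K L : Code) → (Dom K → Dom L) → Set
IsEmbedding K L f = ∀ x y → x ≤[ K ] y ⇔ f x ≤[ L ] f y

infix 4 _≼_

_≼_ : Rel Code 0ℓ
K ≼ L = ∃ (IsEmbedding K L)

DownwardClosed : Pred Code ℓ → Set ℓ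
DownwardClosed 𝓛 = ∀ {K L} → K ∈ Lin → L ∈ 𝓛 → K ≼ L → K ∈ 𝓛

Subset : Code → Set₁
Subset L = Pred (Dom L) 0ℓ

Convex : (L : Code) → Pred (Subset L) 0ℓ
Convex L I = ∀ {x y z} → x ∈ I → z ∈ I → x ≤[ L ] y → y ≤[ L ] z → y ∈ I

SetLE SetLT : (L : Code) → Rel (Subset L) 0ℓ
SetLE L A B = ∀ {a b} → a ∈ A → b ∈ B → a ≤[ L ] b
SetLT L A B = ∀ {a b} → a ∈ A → b ∈ B → a <[ L ] b

image : (K L : Code) → (Dom K → Dom L) → Subset K → Subset L
image K L f A y = ∃ λ x → x ∈ A × f x ≡ y

record IsConvexPartition (K L : Code) (P : Dom K → Subset L) : Set where
  field
    nonempty : ∀ k → Satisfiable (P k)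
    cover    : ∀ x → ∃ λ k → x ∈ P k
    disjoint : ∀ {x k k′} → x ∈ P k → x ∈ P k′ → k ≡ k′
    ordered  : ∀ k k′ → k <[ K ] k′ ⇔ SetLT L (P k) (P k′)

infix 4 _⊴[_]_

_⊴[_]_ : Code → Pred Code ℓ → Code → Set (suc 0ℓ ⊔ ℓ)
L ⊴[ 𝓛 ] L′ =
  ∃ λ K → K ∈ 𝓛 ×
  ∃ λ (P : Dom K → Subset L) → IsConvexPartition K L P ×
  ∃ λ (f : Dom L → Dom L′) → IsEmbedding L L′ f ×
    (∀ k → Convex L′ (image L L′ f (P k)))

⊴LO : Pred Code ℓ → Rel (∃ LO) (suc 0ℓ ⊔ ℓ)
⊴LO 𝓛 = (λ L L′ → L ⊴[ 𝓛 ] L′) on proj₁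

module _ {K K′ : Code} (P : Dom K → Subset K′) where

  Sum : Set
  Sum = Σ (Dom K′ × Dom K) λ (x , k) → x ∈ P k

  -- Proofs of membership in P k need not be unique, so elements of the sum are
  -- compared by their underlying pairs.
  _≈Sum_ : Rel Sum 0ℓ
  _≈Sum_ = _≡_ on proj₁

  -- Antilexicographic: the index k is compared first.
  _≤Sum_ : Rel Sum 0ℓ
  _≤Sum_ = ×-Lex _≡_ (LE K) (LE K′) on (swap ∘ proj₁)

-- The sum is not literally a code; its membership in 𝓛 means that 𝓛 contains
-- an isomorphic code.
ClosedUnderConvexSums : Pred Code ℓ → Set (suc 0ℓ ⊔ ℓ)
ClosedUnderConvexSums 𝓛 =
  ∀ {K K′} → K ∈ 𝓛 → K′ ∈ 𝓛 → (P : Dom K → Subset K′) →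
  (∀ k → Satisfiable (P k)) →
  (∀ k → Convex K′ (P k)) →
  (∀ {k₀ k₁} → k₀ <[ K ] k₁ → SetLE K′ (P k₀) (P k₁)) →
  ∃ λ M → M ∈ 𝓛 ×
    ∃ (IsOrderIsomorphism _≡_ (_≈Sum_ {K} {K′} P) (LE M) (_≤Sum_ {K} {K′} P))

IsBasis : {X : Set} → Rel X ℓ → Pred X ℓ′ → Set (ℓ ⊔ ℓ′)
IsBasis _≲_ 𝓑 = ∀ x → ∃ λ b → b ∈ 𝓑 × b ≲ x

{-# OPTIONS --safe #-}
module Submission where

-- Say ω ∈ 𝓛, and let L be a linear order on ℕ.  Either L contains a strictly
-- increasing sequence, or it ends in a copy of ω*.
--
--   * A strictly increasing sequence is an embedding of ω into L.  Partition ω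
--     into singletons: the index order is ω itself, which lies in 𝓛, and the
--     image of a singleton is a singleton, hence convex.  So ω ⊴ L.
--     (⊴-singletons)
--   * A final segment is convex, so the embedding of ω* onto it works with the
--     partition of ω* into one piece.  Its index order has one point and lies
--     in 𝓛 by downward closure.  So ω* ⊴ L.  (⊴-whole)
--
-- The case ω* ∈ 𝓛 is the same argument for the reverse of L.
--
-- The dichotomy (increasing⊎finalω*) is obtained by peeling off maxima: take
-- the greatest element of L, then the greatest of the remaining ones, and so
-- on.  If this never stops, the removed elements form the final copy of ω*.  If
-- it stops, then some finite up-closed set has a complement with no greatest
-- element; this complement is nonempty because L is infinite, so one can climb
-- in it forever.  Each climbing step, and each maximum, is a function of the
-- current state supplied by excluded middle, so no choice principle is needed.

open import Defs
open import Level using (Level; 0ℓ)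
open import Axiom.ExcludedMiddle using (ExcludedMiddle)
open import Data.Bool.Base using (true; false)
open import Data.List.Base using (List; []; _∷_; map)
open import Data.List.Extrema.Nat using (max; xs≤max)
open import Data.List.Membership.Propositional using (_∉_) renaming (_∈_ to _∈ˡ_)
open import Data.List.Membership.Propositional.Properties using (∈-map⁺)
open import Data.List.Relation.Unary.All using (lookup)
open import Data.List.Relation.Unary.Any using (here; there)
open import Data.Nat.Base using (ℕ; zero; suc; _≤ᵇ_)
open import Data.Nat.Properties using (≤ᵇ⇒≤; ≤⇒≤ᵇ; ≤⇒≤′; _≤?_; 1+n≰n)
open import Data.Product.Base using (∃; _×_; _,_; proj₁; proj₂)
open import Data.Sum.Base using (_⊎_; inj₁; inj₂)
open import Data.Unit.Base using (tt)
open import Function.Base using (_∘_; flip)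
open import Function.Bundles using (_⇔_; mk⇔; Equivalence)
open import Relation.Binary.Core using (Rel)
open import Relation.Binary.PropositionalEquality using (_≡_; refl; sym; isEquivalence)
open import Relation.Binary.Structures using (IsTotalOrder)
open import Relation.Nullary using (¬_; yes; no; contradiction)
open import Relation.Nullary.Decidable using (decidable-stable)
open import Relation.Unary using (Pred; _∈_; _⊆_; _∪_; ｛_｝; U; Satisfiable)
import Data.Nat.Base as ℕ
import Data.Nat.Properties as ℕ using (≰⇒>)
import Relation.Binary.Construct.Flip.EqAndOrd as Flip
import Relation.Binary.Construct.NonStrictToStrict as NonStrictToStrict

-- Sequences in a total order

-- Stated for a reflexive order and its strict part; applied to a flipped order
-- it says that the sequence is strictly decreasing.
StrictlyIncreasing : {A : Set} → Rel A 0ℓ → (ℕ → A) → Set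
StrictlyIncreasing _≤_ g = ∀ n → g n < g (suc n)
  where open NonStrictToStrict _≡_ _≤_ using (_<_)

module _ {A : Set} {_≤_ : Rel A 0ℓ} (O : IsTotalOrder _≡_ _≤_) where

  open IsTotalOrder O using (reflexive; antisym; total)
    renaming (refl to ≤-refl; trans to ≤-trans)
  open NonStrictToStrict _≡_ _≤_ using (_<_; <⇒≱; ≰⇒>)

  module _ {g : ℕ → A} (g↑ : StrictlyIncreasing _≤_ g) where

    increasing⇒≤ : ∀ {m n} → m ℕ.≤′ n → g m ≤ g n
    increasing⇒≤ ℕ.≤′-refl       = ≤-refl
    increasing⇒≤ (ℕ.≤′-step m≤n) = ≤-trans (increasing⇒≤ m≤n) (proj₁ (g↑ _))

    increasing⇒embedding : ∀ m n → m ℕ.≤ n ⇔ g m ≤ g n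
    increasing⇒embedding m n = mk⇔ (increasing⇒≤ ∘ ≤⇒≤′) reflects
      where
      reflects : g m ≤ g n → m ℕ.≤ n
      reflects gm≤gn with m ≤? n
      ... | yes m≤n = m≤n
      ... | no  m≰n = contradiction
        (≤-trans (increasing⇒≤ (≤⇒≤′ (ℕ.≰⇒> m≰n))) gm≤gn)
        (<⇒≱ antisym (g↑ n))

  -- The range of g is up-closed; for a strictly decreasing g the range is
  -- then a final segment of order type ω*.
  RangeUpClosed : (ℕ → A) → Set
  RangeUpClosed g = ∀ n {y} → g n ≤ y → ∃ λ i → g i ≡ y

  module _ (em : ExcludedMiddle 0ℓ) where

    private
      -- Finite up-closed sets, given by a list of their elements.
      UpClosed : List A → Set
      UpClosed xs = ∀ {x y} → x ∈ˡ xs → x ≤ y → y ∈ˡ xs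

      -- The greatest element of the complement of xs.
      GreatestOutside : List A → A → Set
      GreatestOutside xs m = m ∉ xs × (∀ {y} → y ∉ xs → y ≤ m)

    -- If the complement of xs is nonempty and has no greatest element, then every
    -- element of it lies strictly below another one.
    climb : ∀ xs → (∃ λ x → x ∉ xs) → ¬ (∃ (GreatestOutside xs)) →
            ∃ (StrictlyIncreasing _≤_)
    climb xs x₀ noGreatest = proj₁ ∘ state , λ n → proj₂ (proj₂ (above (state n)))
      where
      above : ((x , _) : ∃ (_∉ xs)) → ∃ λ y → y ∉ xs × x < y
      above (x , x∉xs) = decidable-stable em λ none → noGreatest
        ( x , x∉xs , λ {y} y∉xs → decidable-stable em λ y≰x →
          none (y , y∉xs , ≰⇒> sym reflexive total y≰x) )

      state : ℕ → ∃ (_∉ xs)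
      state zero    = x₀
      state (suc n) = let (y , y∉xs , _) = above (state n) in y , y∉xs

    -- g n is the greatest element outside the set of g 0, ..., g (n - 1).  The set
    -- stays up-closed because only its complement's maximum is ever added.
    peel : (∀ xs → UpClosed xs → ∃ (GreatestOutside xs)) →
           ∃ λ g → StrictlyIncreasing (flip _≤_) g × RangeUpClosed g
    peel greatest = g , decreasing , upClosed
      where
      add : ∃ UpClosed → ∃ UpClosed
      add (xs , up) = let (m , m∉xs , ≤m) = greatest xs up in
        m ∷ xs , λ
        { {y = y} (here refl) m≤y → decidable-stable em λ y∉ →
            y∉ (here (antisym (≤m (y∉ ∘ there)) m≤y))
        ; (there x∈xs) x≤y → there (up x∈xs x≤y)
        }

      -- The set of the first n elements removed.
      removed : ℕ → ∃ UpClosed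
      removed zero    = [] , λ ()
      removed (suc n) = add (removed n)

      g : ℕ → A
      g n = let (xs , up) = removed n in proj₁ (greatest xs up)

      g-greatest : ∀ n → GreatestOutside (proj₁ (removed n)) (g n)
      g-greatest n = let (xs , up) = removed n in proj₂ (greatest xs up)

      decreasing : StrictlyIncreasing (flip _≤_) g
      decreasing n = let g∉ = proj₁ (g-greatest (suc n)) in
        proj₂ (g-greatest n) (g∉ ∘ there) , λ eq → g∉ (here (sym eq))

      removed⇒range : ∀ n {y} → y ∈ˡ proj₁ (removed n) → ∃ λ i → g i ≡ y
      removed⇒range (suc n) (here refl) = n , refl
      removed⇒range (suc n) (there y∈)  = removed⇒range n y∈

      upClosed : RangeUpClosed g
      upClosed n gn≤y =
        removed⇒range (suc n) (proj₂ (removed (suc n)) (here refl) gn≤y)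

    increasing⊎finalω* :
      (∀ xs → ∃ λ (x : A) → x ∉ xs) →
      ∃ (StrictlyIncreasing _≤_) ⊎
      ∃ λ g → StrictlyIncreasing (flip _≤_) g × RangeUpClosed g
    increasing⊎finalω* fresh
      with em {∃ λ xs → UpClosed xs × ¬ (∃ (GreatestOutside xs))}
    ... | yes (xs , _ , noGreatest) = inj₁ (climb xs (fresh xs) noGreatest)
    ... | no  never = inj₂ (peel λ xs up →
            decidable-stable em λ noGreatest → never (xs , up , noGreatest))

-- Coded linear orders

LO-infinite : ∀ {L} → LO L → (xs : List (Dom L)) → ∃ λ x → x ∉ xs
LO-infinite lo xs = (k , LO.full lo k) ,
  λ x∈xs → 1+n≰n (lookup (xs≤max 0 (map proj₁ xs)) (∈-map⁺ proj₁ x∈xs))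
  where
  k : ℕ
  k = suc (max 0 (map proj₁ xs))

-- The order on the single point 0.
𝟏 : Code
𝟏 zero zero = true
𝟏 _    _    = false

𝟏-unique : (x y : Dom 𝟏) → x ≡ y
𝟏-unique (zero , _) (zero , _) = refl

𝟏-Fin : Fin 𝟏
𝟏-Fin = record
  { isLinear = record
    { supported    = λ { {zero} {zero} _ → tt , tt }
    ; isTotalOrder = record
      { isPartialOrder = record
        { isPreorder = record
          { isEquivalence = isEquivalence
          ; reflexive     = λ { {zero , _} refl → tt }
          ; trans         = λ { {zero , _} {_} {zero , _} _ _ → tt }
          }
        ; antisym = λ {x} {y} _ _ → 𝟏-unique x y
        }
      ; total = λ { (zero , _) (zero , _) → inj₁ tt }
      }
    }
  ; nonempty = zero , tt
  ; finite   = (zero , tt) ∷ [] , λ x → here (𝟏-unique x (zero , tt))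
  }

𝟏≼ : ∀ {L} → LO L → 𝟏 ≼ L
𝟏≼ lo = (λ _ → 0 , LO.full lo 0) ,
  λ { (zero , _) (zero , _) → mk⇔ (λ _ → LO.full lo 0) (λ _ → tt) }

-- Two ways to obtain L ⊴ L′

module _ {ℓ : Level} {𝓛 : Pred Code ℓ} where

  ⊴-singletons : ∀ {L L′} → L ∈ 𝓛 → IsLinear L′ → L ≼ L′ → L ⊴[ 𝓛 ] L′
  ⊴-singletons {L} {L′} L∈𝓛 lin (f , emb) =
    L , L∈𝓛 , ｛_｝ , partition , f , emb ,
    λ { k (_ , refl , refl) (_ , refl , refl) fk≤y y≤fk →
        k , refl , IsTotalOrder.antisym (IsLinear.isTotalOrder lin) fk≤y y≤fk }
    where
    partition : IsConvexPartition L L ｛_｝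
    partition = record
      { nonempty = λ k → k , refl
      ; cover    = λ x → x , refl
      ; disjoint = λ { refl refl → refl }
      ; ordered  = λ _ _ → mk⇔ (λ { k<k′ refl refl → k<k′ }) (λ lt → lt refl refl)
      }

  ⊴-whole : ∀ {L L′} → 𝟏 ∈ 𝓛 → Dom L → ((f , _) : L ≼ L′) →
            Convex L′ (image L L′ f U) → L ⊴[ 𝓛 ] L′
  ⊴-whole {L} 𝟏∈𝓛 x₀ (f , emb) convex =
    𝟏 , 𝟏∈𝓛 , (λ _ → U) , partition , f , emb , λ _ → convex
    where
    partition : IsConvexPartition 𝟏 L (λ _ → U)
    partition = record
      { nonempty = λ _ → x₀ , tt
      ; cover    = λ _ → (zero , tt) , tt
      ; disjoint = λ {_} {k} {k′} _ _ → 𝟏-unique k k′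
      -- Both sides are false: U is not strictly below itself.
      ; ordered  = λ k k′ → mk⇔
          (λ (_ , k≢k′) → contradiction (𝟏-unique k k′) k≢k′)
          (λ lt → contradiction refl (proj₂ (lt {x₀} {x₀} tt tt)))
      }

-- Monotone sequences as embeddings of ω and ω*

module _ {L : Code} (O : IsTotalOrder _≡_ (LE L)) where

  increasing⇒ω≼ : ∀ g → StrictlyIncreasing (LE L) g → proj₁ ω ≼ L
  increasing⇒ω≼ g g↑ = g ∘ proj₁ , λ (m , _) (n , _) →
    let open Equivalence (increasing⇒embedding O g↑ m n) in
    mk⇔ (to ∘ ≤ᵇ⇒≤ m n) (≤⇒≤ᵇ ∘ from)

  decreasing⇒ω*≼ : ∀ g → StrictlyIncreasing (flip (LE L)) g → proj₁ ω* ≼ L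
  decreasing⇒ω*≼ g g↓ = g ∘ proj₁ , λ (m , _) (n , _) →
    let open Equivalence (increasing⇒embedding (Flip.isTotalOrder O) g↓ n m) in
    mk⇔ (to ∘ ≤ᵇ⇒≤ n m) (≤⇒≤ᵇ ∘ from)

theorem5p4 : ExcludedMiddle 0ℓ →
    {ℓ : Level} (𝓛 : Pred Code ℓ) →
    𝓛 ⊆ Lin →
    Satisfiable 𝓛 →
    DownwardClosed 𝓛 →
    ClosedUnderConvexSums 𝓛 →
    (proj₁ ω* ∈ 𝓛) ⊎ (proj₁ ω ∈ 𝓛) →
    IsBasis (⊴LO 𝓛) (｛ ω ｝ ∪ ｛ ω* ｝)
theorem5p4 em 𝓛 _ _ down _ (inj₂ ω∈𝓛) (L , lo)
  with O ← IsLinear.isTotalOrder (LO.isLinear lo)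
  with increasing⊎finalω* O em (LO-infinite lo)
... | inj₁ (g , g↑) =
      ω , inj₁ refl , ⊴-singletons ω∈𝓛 (LO.isLinear lo) (increasing⇒ω≼ O g g↑)
... | inj₂ (g , g↓ , up) =
      ω* , inj₂ refl , ⊴-whole {L′ = L} 𝟏∈𝓛 (0 , tt) (decreasing⇒ω*≼ O g g↓)
        λ { ((i , _) , _ , refl) _ gi≤y _ →
            let (j , eq) = up i gi≤y in (j , LO.full (proj₂ ω*) j) , tt , eq }
  where
  𝟏∈𝓛 : 𝟏 ∈ 𝓛
  𝟏∈𝓛 = down (inj₁ 𝟏-Fin) ω∈𝓛 (𝟏≼ (proj₂ ω))
-- The dichotomy is applied to the reverse of L, where increasing sequences are
-- the decreasing ones of L and a final copy of ω* is an initial copy of ω.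
theorem5p4 em 𝓛 _ _ down _ (inj₁ ω*∈𝓛) (L , lo)
  with O ← IsLinear.isTotalOrder (LO.isLinear lo)
  with increasing⊎finalω* (Flip.isTotalOrder O) em (LO-infinite lo)
... | inj₁ (g , g↓) =
      ω* , inj₂ refl , ⊴-singletons ω*∈𝓛 (LO.isLinear lo) (decreasing⇒ω*≼ O g g↓)
... | inj₂ (g , g↑ , down-closed) =
      ω , inj₁ refl , ⊴-whole {L′ = L} 𝟏∈𝓛 (0 , tt) (increasing⇒ω≼ O g g↑)
        λ { _ ((i , _) , _ , refl) _ y≤gi →
            let (j , eq) = down-closed i y≤gi in (j , LO.full (proj₂ ω) j) , tt , eq }
  where
  𝟏∈𝓛 : 𝟏 ∈ 𝓛
  𝟏∈𝓛 = down (inj₁ 𝟏-Fin) ω*∈𝓛 (𝟏≼ (proj₂ ω*))
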